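{- Let $f$ be a nondecreasing unbounded function from $\mathbb{N}$ to $\mathbb{N}$ with $f(n)=o(n)$. Let $c>1$ be a constant and let $\epsilon$ be an arbitrary small constant in $(0,\sqrt{c}-1)$. Then every randomized $(\sqrt{c}-\epsilon)$-approximation algorithm for the sum problem in $\sum(c,f(n))$ needs $\Omega\!\left(\frac{n}{f(n)}\right)$ time.
   Context: The sum problem: given a list of nonnegative real numbers $a_1,\ldots,a_n$, approximate $\sum_{i=1}^n a_i$. For $k\ge 1$, a real number $s$ is a $k$-approximation for the sum problem $a_1,\ldots,a_n$ if $\frac{1}{k}\sum_{i=1}^n a_i\le s\le k\sum_{i=1}^n a_i$. For a function $f$ and a parameter $c>1$, $\sum(c,f(n))$ denotes the class of sum problems whose input is a list of nonnegative numbers $a_1,\ldots,a_n$ with $\sum_{i=1}^n a_i\in\left[\frac{f(n)}{c},\,c f(n)\right]$. A randomized $k$-approximation algorithm for $\sum(c,f(n))$ is a randomized algorithm that, on every input list in $\sum(c,f(n))$, outputs a $k$-approximation for its sum with probability at least $3/4$. The algorithm is given $n$ and learns about the list only by reading items (at uniformly random positions, or at positions it chooses), each read costing at least one unit of time. "Needs $\Omega(n/f(n))$ time" means that there is a constant $\kappa>0$ such that for all sufficiently large $n$ the worst-case running time, over inputs of length $n$ in $\sum(c,f(n))$ and over the random choices, is at least $\kappa n/f(n)$. -}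

module Defs where

open import Algebra.Properties.CommutativeMonoid.Sum using (sum)
open import Data.Bool.Base using (Bool; true; if_then_else_)
open import Data.Fin.Base using (Fin)
open import Data.Integer.Base as ℤ using (+_)
open import Data.Maybe.Base using (Maybe; just; nothing)
import Data.Maybe.Relation.Unary.Any as Maybe
open import Data.Nat.Base as ℕ using (ℕ; zero; suc)
import Data.Nat.Properties as ℕₚ
import Data.Integer.Properties as ℤₚ
open import Data.Integer.Solver using () renaming (module +-*-Solver to ℤS)
open import Data.Product.Base using (Σ; ∃-syntax; _×_; _,_; proj₁; proj₂)
open import Data.Rational.Base as ℚ using (ℚ; mkℚ; 0ℚ; 1ℚ; ½)
import Data.Rational.Properties as ℚₚ
import Data.Rational.Unnormalised.Base as ℚᵘ
import Data.Rational.Unnormalised.Properties as ℚᵘₚ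
open import Data.Rational.Solver using (module +-*-Solver)
open import Data.Sum.Base using (inj₁; inj₂)
open import Data.Unit.Base using (⊤; tt)
open import Data.Vec.Base using (Vec; lookup; foldr′)
open import Data.Vec.Relation.Unary.All using (All)
open import Relation.Binary.PropositionalEquality
open import Relation.Nullary using (yes; no; contradiction)

module RationalLemmas where
  open import Data.Rational.Base
  open +-*-Solver

  mul-mono-≤ : ∀ {p q r s} → 0ℚ ≤ p → p ≤ q → 0ℚ ≤ r → r ≤ s → p * r ≤ q * s
  mul-mono-≤ {p} {q} {r} {s} 0≤p p≤q 0≤r r≤s = ℚₚ.≤-trans
    (ℚₚ.*-monoˡ-≤-nonNeg p {{nonNegative 0≤p}} r≤s)
    (ℚₚ.*-monoʳ-≤-nonNeg s {{nonNegative (ℚₚ.≤-trans 0≤r r≤s)}} p≤q)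

  mul-nonneg : ∀ {p q} → 0ℚ ≤ p → 0ℚ ≤ q → 0ℚ ≤ p * q
  mul-nonneg {p} {q} 0≤p 0≤q = ℚₚ.nonNegative⁻¹ (p * q)
    {{ℚₚ.nonNeg*nonNeg⇒nonNeg p {{nonNegative 0≤p}} q {{nonNegative 0≤q}}}}

  mul-pos : ∀ {p q} → 0ℚ < p → 0ℚ < q → 0ℚ < p * q
  mul-pos {p} {q} 0<p 0<q = ℚₚ.positive⁻¹ (p * q)
    {{ℚₚ.pos*pos⇒pos p {{positive 0<p}} q {{positive 0<q}}}}

  0<1 : 0ℚ < 1ℚ
  0<1 = ℚₚ.positive⁻¹ 1ℚ

  half-pos : ∀ {ε} → 0ℚ < ε → 0ℚ < ½ * ε
  half-pos = mul-pos (ℚₚ.positive⁻¹ ½)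

  half+half : ∀ ε → ½ * ε + ½ * ε ≡ ε
  half+half = solve 1 (λ e → con ½ :* e :+ con ½ :* e := e) refl

  ≤∣∣ : ∀ p → p ≤ ∣ p ∣
  ≤∣∣ p with ℚₚ.≤-total 0ℚ p
  ... | inj₁ 0≤p = ℚₚ.≤-reflexive (sym (ℚₚ.0≤p⇒∣p∣≡p 0≤p))
  ... | inj₂ p≤0 = ℚₚ.≤-trans p≤0 (ℚₚ.0≤∣p∣ p)

  dist-sym : ∀ p q → ∣ p - q ∣ ≡ ∣ q - p ∣
  dist-sym p q = trans (sym (ℚₚ.∣-p∣≡∣p∣ (p - q)))
    (cong ∣_∣ (solve 2 (λ p q → :- (p :- q) := q :- p) refl p q))

  ≤+dist : ∀ p q → p ≤ q + ∣ p - q ∣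
  ≤+dist p q = subst (_≤ q + ∣ p - q ∣)
    (solve 2 (λ p q → q :+ (p :- q) := p) refl p q) (ℚₚ.+-monoʳ-≤ q (≤∣∣ (p - q)))

  dist-≤ : ∀ {p q ε} → p ≤ q + ε → q ≤ p + ε → ∣ p - q ∣ ≤ ε
  dist-≤ {p} {q} {ε} p≤ q≤ with ℚₚ.∣p∣≡p∨∣p∣≡-p (p - q)
  ... | inj₁ eq = subst₂ _≤_ (sym eq) (solve 2 (λ q e → q :+ e :- q := e) refl q ε)
                    (ℚₚ.+-monoˡ-≤ (- q) p≤)
  ... | inj₂ eq = subst₂ _≤_
                    (trans (solve 2 (λ p q → q :- p := :- (p :- q)) refl p q) (sym eq))
                    (solve 2 (λ p e → p :+ e :- p := e) refl p ε)
                    (ℚₚ.+-monoˡ-≤ (- p) q≤)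

  sq-cancel : ∀ {p q} → 0ℚ ≤ q → p * p ≤ q * q → p ≤ q
  sq-cancel {p} {q} 0≤q p²≤q² with p ℚₚ.≤? q
  ... | yes p≤q = p≤q
  ... | no p≰q = contradiction (ℚₚ.<-≤-trans (ℚₚ.≤-<-trans
          (ℚₚ.*-monoˡ-≤-nonNeg q {{nonNegative 0≤q}} (ℚₚ.<⇒≤ q<p))
          (ℚₚ.*-monoˡ-<-pos p {{positive (ℚₚ.≤-<-trans 0≤q q<p)}} q<p)) p²≤q²)
          (ℚₚ.<-irrefl refl)
    where q<p = ℚₚ.≰⇒> p≰q

  recip : ℚ → ℚ
  recip q with q ℚₚ.≟ 0ℚ
  ... | yes _  = 0ℚ
  ... | no q≢0 = (1/ q) {{≢-nonZero q≢0}}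

  recip-inverse : ∀ {q} → 0ℚ < q → q * recip q ≡ 1ℚ
  recip-inverse {q} 0<q with q ℚₚ.≟ 0ℚ
  ... | yes q≡0 = contradiction (sym q≡0) (ℚₚ.<⇒≢ 0<q)
  ... | no q≢0  = ℚₚ.*-inverseʳ q {{≢-nonZero q≢0}}

  recip-pos : ∀ {q} → 0ℚ < q → 0ℚ < recip q
  recip-pos {q} 0<q with q ℚₚ.≟ 0ℚ
  ... | yes q≡0 = contradiction (sym q≡0) (ℚₚ.<⇒≢ 0<q)
  ... | no q≢0  = ℚₚ.positive⁻¹ _ {{ℚₚ.1/pos⇒pos q {{positive 0<q}}}}

  recip-mono : ∀ {p q} → 0ℚ < p → p ≤ q → recip q ≤ recip p
  recip-mono {p} {q} 0<p p≤q = begin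
    recip q                 ≡⟨ sym (ℚₚ.*-identityʳ (recip q)) ⟩
    recip q * 1ℚ            ≡⟨ cong (recip q *_) (sym (recip-inverse 0<p)) ⟩
    recip q * (p * recip p) ≤⟨ mul-mono-≤ (ℚₚ.<⇒≤ (recip-pos 0<q)) ℚₚ.≤-refl (mul-nonneg (ℚₚ.<⇒≤ 0<p) 0≤1/p) (mul-mono-≤ (ℚₚ.<⇒≤ 0<p) p≤q 0≤1/p ℚₚ.≤-refl) ⟩
    recip q * (q * recip p) ≡⟨ solve 3 (λ q q⁻¹ p⁻¹ → q⁻¹ :* (q :* p⁻¹) := q :* q⁻¹ :* p⁻¹) refl q (recip q) (recip p) ⟩
    q * recip q * recip p   ≡⟨ cong (_* recip p) (recip-inverse 0<q) ⟩
    1ℚ * recip p            ≡⟨ ℚₚ.*-identityˡ (recip p) ⟩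
    recip p                 ∎
    where open ℚₚ.≤-Reasoning
          0<q   = ℚₚ.<-≤-trans 0<p p≤q
          0≤1/p = ℚₚ.<⇒≤ (recip-pos 0<p)

  dist-recip : ∀ {p q} → 0ℚ < p → 0ℚ < q →
               ∣ recip p - recip q ∣ ≡ ∣ q - p ∣ * (recip p * recip q)
  dist-recip {p} {q} 0<p 0<q = begin
    ∣ recip p - recip q ∣
      ≡⟨ cong ∣_∣ (cong₂ _-_ (sym (ℚₚ.*-identityˡ (recip p))) (sym (ℚₚ.*-identityˡ (recip q)))) ⟩
    ∣ 1ℚ * recip p - 1ℚ * recip q ∣
      ≡⟨ cong ∣_∣ (cong₂ (λ a b → a * recip p - b * recip q) (sym (recip-inverse 0<q)) (sym (recip-inverse 0<p))) ⟩
    ∣ q * recip q * recip p - p * recip p * recip q ∣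
      ≡⟨ cong ∣_∣ (solve 4 (λ p q a b → q :* b :* a :- p :* a :* b := (q :- p) :* (a :* b)) refl p q (recip p) (recip q)) ⟩
    ∣ (q - p) * (recip p * recip q) ∣
      ≡⟨ ℚₚ.∣p*q∣≡∣p∣*∣q∣ (q - p) (recip p * recip q) ⟩
    ∣ q - p ∣ * ∣ recip p * recip q ∣
      ≡⟨ cong (∣ q - p ∣ *_) (ℚₚ.0≤p⇒∣p∣≡p (ℚₚ.<⇒≤ (mul-pos (recip-pos 0<p) (recip-pos 0<q)))) ⟩
    ∣ q - p ∣ * (recip p * recip q) ∎
    where open ≡-Reasoning

  unit : ℕ → ℚ
  unit n = + 1 / suc n

  toℚᵘ-/ : ∀ i n → toℚᵘ (i / suc n) ℚᵘ.≃ ℚᵘ.mkℚᵘ i n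
  toℚᵘ-/ i n = ℚₚ.toℚᵘ-fromℚᵘ (ℚᵘ.mkℚᵘ i n)

  grid-suc : ∀ n j → + suc j / suc n ≡ + j / suc n + unit n
  grid-suc n j = ℚₚ.toℚᵘ-injective (begin
    toℚᵘ (+ suc j / suc n)                       ≈⟨ toℚᵘ-/ (+ suc j) n ⟩
    ℚᵘ.mkℚᵘ (+ suc j) n                          ≈⟨ ℚᵘ.*≡* (ℤS.solve 2 (λ j d →
        (ℤS.con (+ 1) ℤS.:+ j) ℤS.:* (d ℤS.:* d) ℤS.:=
        (j ℤS.:* d ℤS.:+ ℤS.con (+ 1) ℤS.:* d) ℤS.:* d) refl (+ j) (+ suc n)) ⟩
    ℚᵘ.mkℚᵘ (+ j) n ℚᵘ.+ ℚᵘ.mkℚᵘ (+ 1) n         ≈⟨ ℚᵘₚ.+-cong (toℚᵘ-/ (+ j) n) (toℚᵘ-/ (+ 1) n) ⟨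
    toℚᵘ (+ j / suc n) ℚᵘ.+ toℚᵘ (unit n)        ≈⟨ ℚₚ.toℚᵘ-homo-+ (+ j / suc n) (unit n) ⟨
    toℚᵘ (+ j / suc n + unit n)                  ∎)
    where open ℚᵘₚ.≃-Reasoning

  grid-nonneg : ∀ n j → 0ℚ ≤ + j / suc n
  grid-nonneg n j = ℚₚ.nonNegative⁻¹ _ {{ℚₚ.normalize-nonNeg j (suc n)}}

  unit-pos : ∀ n → 0ℚ < unit n
  unit-pos n = ℚₚ.positive⁻¹ _ {{ℚₚ.normalize-pos 1 (suc n)}}

  unit-small : ∀ {ε} → 0ℚ < ε → ∃[ N ] ∀ n → N ℕ.≤ n → unit n ≤ ε
  unit-small {mkℚ (+ zero) d c} 0<ε = contradiction refl (ℚₚ.<⇒≢ (subst (0ℚ <_) (ℚₚ.↥p≡0⇒p≡0 (mkℚ (+ zero) d c) refl) 0<ε))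
  unit-small {mkℚ ℤ.-[1+ k ] d c} 0<ε = contradiction 0<ε (ℚₚ.<-asym (ℚₚ.negative⁻¹ _))
  unit-small {ε@(mkℚ ℤ.+[1+ k ] d c)} 0<ε = d , λ n d≤n →
    ℚₚ.toℚᵘ-cancel-≤ (ℚᵘₚ.≤-respˡ-≃ (ℚᵘₚ.≃-sym (toℚᵘ-/ (+ 1) n))
      (ℚᵘ.*≤* (ℤ.+≤+ (ℕₚ.*-mono-≤ {1} {suc k} (ℕ.s≤s ℕ.z≤n) (ℕ.s≤s d≤n)))))

  -- The largest j ≤ b with s j ≤ q, and 0 if there is none.
  largest : (ℕ → ℚ) → ℚ → ℕ → ℕ
  largest s q zero = zero
  largest s q (suc b) with s (suc b) ℚₚ.≤? q
  ... | yes _ = suc b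
  ... | no  _ = largest s q b

  largest-lower : ∀ (s : ℕ → ℚ) {q} b → s 0 ≤ q → s (largest s q b) ≤ q
  largest-lower s zero s0≤q = s0≤q
  largest-lower s {q} (suc b) s0≤q with s (suc b) ℚₚ.≤? q
  ... | yes p = p
  ... | no  _ = largest-lower s b s0≤q

  largest-upper : ∀ (s : ℕ → ℚ) {q} b → q < s (suc b) → q < s (suc (largest s q b))
  largest-upper s zero q< = q<
  largest-upper s {q} (suc b) q< with s (suc b) ℚₚ.≤? q
  ... | yes _ = q<
  ... | no ¬p = largest-upper s b (ℚₚ.≰⇒> ¬p)

  gridSq : ℕ → ℕ → ℚ
  gridSq n j = (+ j / suc n) * (+ j / suc n)

  gridSq-0 : ∀ {q} n → 0ℚ ≤ q → gridSq n 0 ≤ q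
  gridSq-0 {q} n 0≤q = subst (λ z → z * z ≤ q) (sym (ℚₚ.0/n≡0 (suc n))) 0≤q

  -- (rootBound q n + 1) / (n + 1) = ∣ ↥ q ∣ + 1, whose square exceeds q.
  rootBound : ℚ → ℕ → ℕ
  rootBound q n = n ℕ.+ ℤ.∣ ↥ q ∣ ℕ.* suc n

  rootIndex : ℚ → ℕ → ℕ
  rootIndex q n = largest (gridSq n) q (rootBound q n)

  -- For q ≥ 0, the largest multiple of 1 / (n + 1) whose square is at most q.
  root : ℚ → ℕ → ℚ
  root q n = + rootIndex q n / suc n

  root-nonneg : ∀ q n → 0ℚ ≤ root q n
  root-nonneg q n = grid-nonneg n (rootIndex q n)

  rootBound-upper : ∀ {q} n → 0ℚ ≤ q →
                    q < (+ suc (rootBound q n) / suc n) * (+ suc (rootBound q n) / suc n)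
  rootBound-upper {mkℚ ℤ.-[1+ _ ] _ _} n 0≤q =
    contradiction (ℚₚ.≤-<-trans 0≤q (ℚₚ.negative⁻¹ _)) (ℚₚ.<-irrefl refl)
  rootBound-upper {q@(mkℚ (+ p) d _)} n 0≤q = begin-strict
    q       <⟨ q<g ⟩
    g       ≡⟨ sym (ℚₚ.*-identityʳ g) ⟩
    g * 1ℚ  ≤⟨ mul-mono-≤ (grid-nonneg n B) ℚₚ.≤-refl (ℚₚ.<⇒≤ 0<1) 1≤g ⟩
    g * g   ∎
    where
      B = suc (rootBound q n)
      open ℚₚ.≤-Reasoning
      g = + B / suc n
      q<g : q < g
      q<g = ℚₚ.toℚᵘ-cancel-< (ℚᵘₚ.<-respʳ-≃ (ℚᵘₚ.≃-sym (toℚᵘ-/ (+ B) n))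
        (ℚᵘ.*<* (subst₂ ℤ._<_ (ℤₚ.pos-* p (suc n)) (ℤₚ.pos-* B (suc d))
          (ℤ.+<+ (ℕₚ.<-≤-trans (ℕₚ.*-monoˡ-< (suc n) (ℕₚ.n<1+n p)) (ℕₚ.m≤m*n B (suc d)))))))
      1≤g : 1ℚ ≤ g
      1≤g = ℚₚ.toℚᵘ-cancel-≤ (ℚᵘₚ.≤-respʳ-≃ (ℚᵘₚ.≃-sym (toℚᵘ-/ (+ B) n))
        (ℚᵘ.*≤* (ℤ.+≤+ (subst (1 ℕ.* suc n ℕ.≤_) (sym (ℕₚ.*-identityʳ B))
          (ℕₚ.*-monoˡ-≤ (suc n) {1} {suc p} (ℕ.s≤s ℕ.z≤n))))))

  root-lower : ∀ {q} n → 0ℚ ≤ q → root q n * root q n ≤ q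
  root-lower {q} n 0≤q = largest-lower (gridSq n) (rootBound q n) (gridSq-0 n 0≤q)

  root-upper : ∀ {q} n → 0ℚ ≤ q → q < (root q n + unit n) * (root q n + unit n)
  root-upper {q} n 0≤q = subst (λ z → q < z * z) (grid-suc n (rootIndex q n))
    (largest-upper (gridSq n) (rootBound q n) (rootBound-upper n 0≤q))

  root-≤ : ∀ {p q ε} m n → 0ℚ ≤ p → 0ℚ ≤ q → 0ℚ ≤ ε → p ≤ q + (½ * ε) * (½ * ε) → unit n ≤ ½ * ε →
           root p m ≤ root q n + ε
  root-≤ {p} {q} {ε} m n 0≤p 0≤q 0≤ε p≤ u≤ = begin
    root p m                    ≤⟨ sq-cancel 0≤b root²≤ ⟩
    root q n + e + e            ≡⟨ ℚₚ.+-assoc (root q n) e e ⟩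
    root q n + (e + e)          ≡⟨ cong (λ z → root q n + z) (half+half ε) ⟩
    root q n + ε                ∎
    where
      open ℚₚ.≤-Reasoning
      e = ½ * ε
      s = root q n
      u = unit n
      0≤e = mul-nonneg (ℚₚ.nonNegative⁻¹ ½) 0≤ε
      0≤s+e = ℚₚ.+-mono-≤ (root-nonneg q n) 0≤e
      0≤b = ℚₚ.+-mono-≤ 0≤s+e 0≤e
      0≤s+u = ℚₚ.+-mono-≤ (root-nonneg q n) (ℚₚ.<⇒≤ (unit-pos n))
      s+u≤s+e = ℚₚ.+-monoʳ-≤ s u≤
      root²≤ : root p m * root p m ≤ (s + e + e) * (s + e + e)
      root²≤ = begin
        root p m * root p m               ≤⟨ root-lower m 0≤p ⟩
        p                                 ≤⟨ p≤ ⟩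
        q + e * e                         ≤⟨ ℚₚ.+-monoˡ-≤ (e * e) (ℚₚ.<⇒≤ (root-upper n 0≤q)) ⟩
        (s + u) * (s + u) + e * e         ≤⟨ ℚₚ.+-monoˡ-≤ (e * e) (mul-mono-≤ 0≤s+u s+u≤s+e 0≤s+u s+u≤s+e) ⟩
        (s + e) * (s + e) + e * e         ≡⟨ sym (ℚₚ.+-identityʳ _) ⟩
        (s + e) * (s + e) + e * e + 0ℚ    ≤⟨ ℚₚ.+-monoʳ-≤ ((s + e) * (s + e) + e * e) (ℚₚ.+-mono-≤ (mul-nonneg 0≤s+e 0≤e) (mul-nonneg 0≤s+e 0≤e)) ⟩
        (s + e) * (s + e) + e * e + ((s + e) * e + (s + e) * e)
          ≡⟨ solve 2 (λ s e → (s :+ e) :* (s :+ e) :+ e :* e :+ ((s :+ e) :* e :+ (s :+ e) :* e)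
                            := (s :+ e :+ e) :* (s :+ e :+ e)) refl s e ⟩
        (s + e + e) * (s + e + e)         ∎

  0⊔-≤ : ∀ {p q ε} → 0ℚ ≤ ε → p ≤ q + ε → 0ℚ ⊔ p ≤ (0ℚ ⊔ q) + ε
  0⊔-≤ {p} {q} {ε} 0≤ε p≤ = ℚₚ.⊔-lub
    (ℚₚ.+-mono-≤ (ℚₚ.p≤p⊔q 0ℚ q) 0≤ε)
    (ℚₚ.≤-trans p≤ (ℚₚ.+-monoˡ-≤ ε (ℚₚ.p≤q⊔p 0ℚ q)))

open RationalLemmas

record ℝ : Set where
  constructor mkℝ
  field
    seq    : ℕ → ℚ
    cauchy : ∀ ε → 0ℚ ℚ.< ε →
             ∃[ N ] ∀ m n → N ℕ.≤ m → N ℕ.≤ n → ℚ.∣ seq m ℚ.- seq n ∣ ℚ.≤ ε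

open ℝ public

infix 4 _≤_ _<_ _≃_

_≤_ : ℝ → ℝ → Set
x ≤ y = ∀ ε → 0ℚ ℚ.< ε → ∃[ N ] ∀ n → N ℕ.≤ n → seq x n ℚ.≤ seq y n ℚ.+ ε

_<_ : ℝ → ℝ → Set
x < y = ∃[ ε ] 0ℚ ℚ.< ε × ∃[ N ] ∀ n → N ℕ.≤ n → seq x n ℚ.+ ε ℚ.≤ seq y n

_≃_ : ℝ → ℝ → Set
x ≃ y = x ≤ y × y ≤ x

fromℚ : ℚ → ℝ
fromℚ q = mkℝ (λ _ → q) λ ε 0<ε → 0 , λ _ _ _ _ →
  subst (ℚ._≤ ε) (sym (cong ℚ.∣_∣ (ℚₚ.+-inverseʳ q))) (ℚₚ.<⇒≤ 0<ε)

fromℕ : ℕ → ℝ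
fromℕ n = fromℚ (+ n ℚ./ 1)

0ℝ 1ℝ : ℝ
0ℝ = fromℚ 0ℚ
1ℝ = fromℚ 1ℚ

infixl 6 _+_ _-_
infixl 7 _*_
infix  8 -_

_+_ : ℝ → ℝ → ℝ
x + y = mkℝ (λ n → seq x n ℚ.+ seq y n) λ ε 0<ε →
  let M , hx = cauchy x (½ ℚ.* ε) (half-pos 0<ε)
      N , hy = cauchy y (½ ℚ.* ε) (half-pos 0<ε)
  in M ℕ.⊔ N , λ m n N≤m N≤n →
    let a = seq x m ; b = seq y m ; c = seq x n ; d = seq y n in begin
    ℚ.∣ (a ℚ.+ b) ℚ.- (c ℚ.+ d) ∣
      ≡⟨ cong ℚ.∣_∣ (solve 4 (λ a b c d → (a :+ b) :- (c :+ d) := (a :- c) :+ (b :- d)) refl a b c d) ⟩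
    ℚ.∣ (a ℚ.- c) ℚ.+ (b ℚ.- d) ∣
      ≤⟨ ℚₚ.∣p+q∣≤∣p∣+∣q∣ (a ℚ.- c) (b ℚ.- d) ⟩
    ℚ.∣ a ℚ.- c ∣ ℚ.+ ℚ.∣ b ℚ.- d ∣
      ≤⟨ ℚₚ.+-mono-≤ (hx m n (ℕₚ.m⊔n≤o⇒m≤o M N N≤m) (ℕₚ.m⊔n≤o⇒m≤o M N N≤n))
                     (hy m n (ℕₚ.m⊔n≤o⇒n≤o M N N≤m) (ℕₚ.m⊔n≤o⇒n≤o M N N≤n)) ⟩
    ½ ℚ.* ε ℚ.+ ½ ℚ.* ε
      ≡⟨ half+half ε ⟩
    ε ∎
  where open ℚₚ.≤-Reasoning
        open +-*-Solver

-_ : ℝ → ℝ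
- x = mkℝ (λ n → ℚ.- seq x n) λ ε 0<ε →
  let N , h = cauchy x ε 0<ε in N , λ m n N≤m N≤n →
    subst (ℚ._≤ ε)
      (trans (sym (ℚₚ.∣-p∣≡∣p∣ (seq x m ℚ.- seq x n)))
             (cong ℚ.∣_∣ (ℚₚ.neg-distrib-+ (seq x m) (ℚ.- seq x n))))
      (h m n N≤m N≤n)

_-_ : ℝ → ℝ → ℝ
x - y = x + (- y)

eventually-bounded : ∀ x → ∃[ B ] 0ℚ ℚ.< B × (∃[ N ] ∀ n → N ℕ.≤ n → ℚ.∣ seq x n ∣ ℚ.≤ B)
eventually-bounded x = let N , h = cauchy x 1ℚ 0<1 ; a = seq x N in
      ℚ.∣ a ∣ ℚ.+ 1ℚ
    , ℚₚ.+-mono-≤-< (ℚₚ.0≤∣p∣ a) 0<1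
    , N , λ n N≤n → begin
        ℚ.∣ seq x n ∣                     ≡⟨ cong ℚ.∣_∣ (solve 2 (λ a b → b := a :+ (b :- a)) refl a (seq x n)) ⟩
        ℚ.∣ a ℚ.+ (seq x n ℚ.- a) ∣       ≤⟨ ℚₚ.∣p+q∣≤∣p∣+∣q∣ a (seq x n ℚ.- a) ⟩
        ℚ.∣ a ∣ ℚ.+ ℚ.∣ seq x n ℚ.- a ∣   ≤⟨ ℚₚ.+-monoʳ-≤ ℚ.∣ a ∣ (h n N N≤n ℕₚ.≤-refl) ⟩
        ℚ.∣ a ∣ ℚ.+ 1ℚ                    ∎
    where open ℚₚ.≤-Reasoning
          open +-*-Solver

_*_ : ℝ → ℝ → ℝ
x * y = mkℝ (λ n → seq x n ℚ.* seq y n) λ ε 0<ε →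
  let Bx , 0<Bx , M₁ , hx = eventually-bounded x
      By , 0<By , M₂ , hy = eventually-bounded y
      B    = Bx ℚ.+ By
      pB   = ℚ.positive (ℚₚ.+-mono-< 0<Bx 0<By)
      nzB  = ℚₚ.pos⇒nonZero B {{pB}}
      1/B  = (ℚ.1/ B) {{nzB}}
      δ    = ε ℚ.* 1/B
      0<δ  = mul-pos 0<ε (ℚₚ.positive⁻¹ 1/B {{ℚₚ.1/pos⇒pos B {{pB}}}})
      K₁ , cx = cauchy x δ 0<δ
      K₂ , cy = cauchy y δ 0<δ
      M = M₁ ℕ.⊔ M₂
      K = K₁ ℕ.⊔ K₂
  in M ℕ.⊔ K , λ m n N≤m N≤n →
    let a = seq x m ; b = seq y m ; c = seq x n ; d = seq y n
        M≤m = ℕₚ.m⊔n≤o⇒m≤o M K N≤m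
        M≤n = ℕₚ.m⊔n≤o⇒m≤o M K N≤n
        K≤m = ℕₚ.m⊔n≤o⇒n≤o M K N≤m
        K≤n = ℕₚ.m⊔n≤o⇒n≤o M K N≤n
    in begin
    ℚ.∣ a ℚ.* b ℚ.- c ℚ.* d ∣
      ≡⟨ cong ℚ.∣_∣ (solve 4 (λ a b c d → a :* b :- c :* d := a :* (b :- d) :+ d :* (a :- c)) refl a b c d) ⟩
    ℚ.∣ a ℚ.* (b ℚ.- d) ℚ.+ d ℚ.* (a ℚ.- c) ∣
      ≤⟨ ℚₚ.∣p+q∣≤∣p∣+∣q∣ (a ℚ.* (b ℚ.- d)) (d ℚ.* (a ℚ.- c)) ⟩
    ℚ.∣ a ℚ.* (b ℚ.- d) ∣ ℚ.+ ℚ.∣ d ℚ.* (a ℚ.- c) ∣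
      ≡⟨ cong₂ ℚ._+_ (ℚₚ.∣p*q∣≡∣p∣*∣q∣ a (b ℚ.- d)) (ℚₚ.∣p*q∣≡∣p∣*∣q∣ d (a ℚ.- c)) ⟩
    ℚ.∣ a ∣ ℚ.* ℚ.∣ b ℚ.- d ∣ ℚ.+ ℚ.∣ d ∣ ℚ.* ℚ.∣ a ℚ.- c ∣
      ≤⟨ ℚₚ.+-mono-≤
           (mul-mono-≤ (ℚₚ.0≤∣p∣ a) (hx m (ℕₚ.m⊔n≤o⇒m≤o M₁ M₂ M≤m)) (ℚₚ.0≤∣p∣ (b ℚ.- d))
             (cy m n (ℕₚ.m⊔n≤o⇒n≤o K₁ K₂ K≤m) (ℕₚ.m⊔n≤o⇒n≤o K₁ K₂ K≤n)))
           (mul-mono-≤ (ℚₚ.0≤∣p∣ d) (hy n (ℕₚ.m⊔n≤o⇒n≤o M₁ M₂ M≤n)) (ℚₚ.0≤∣p∣ (a ℚ.- c))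
             (cx m n (ℕₚ.m⊔n≤o⇒m≤o K₁ K₂ K≤m) (ℕₚ.m⊔n≤o⇒m≤o K₁ K₂ K≤n))) ⟩
    Bx ℚ.* δ ℚ.+ By ℚ.* δ
      ≡⟨ solve 4 (λ p q e i → p :* (e :* i) :+ q :* (e :* i) := e :* ((p :+ q) :* i)) refl Bx By ε 1/B ⟩
    ε ℚ.* (B ℚ.* 1/B)
      ≡⟨ cong (ε ℚ.*_) (ℚₚ.*-inverseʳ B {{nzB}}) ⟩
    ε ℚ.* 1ℚ
      ≡⟨ ℚₚ.*-identityʳ ε ⟩
    ε ∎
  where open ℚₚ.≤-Reasoning
        open +-*-Solver

<⇒eventually-≥ : ∀ {x} → 0ℝ < x → ∃[ δ ] 0ℚ ℚ.< δ × (∃[ N ] ∀ n → N ℕ.≤ n → δ ℚ.≤ seq x n)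
<⇒eventually-≥ {x} (δ , 0<δ , N , h) = δ , 0<δ , N , λ n N≤n →
  subst (ℚ._≤ seq x n) (ℚₚ.+-identityˡ δ) (h n N≤n)

infix 9 _⁻¹⟨_⟩

_⁻¹⟨_⟩ : (x : ℝ) → 0ℝ < x → ℝ
x ⁻¹⟨ 0<x ⟩ = mkℝ (λ n → recip (seq x n)) λ ε 0<ε →
  let δ , 0<δ , M , hx = <⇒eventually-≥ {x} 0<x
      r = recip δ
      N , h = cauchy x (ε ℚ.* (δ ℚ.* δ)) (mul-pos 0<ε (mul-pos 0<δ 0<δ))
  in M ℕ.⊔ N , λ m n N≤m N≤n →
    let a = seq x m ; b = seq x n
        δ≤a = hx m (ℕₚ.m⊔n≤o⇒m≤o M N N≤m)
        δ≤b = hx n (ℕₚ.m⊔n≤o⇒m≤o M N N≤n)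
        0<a = ℚₚ.<-≤-trans 0<δ δ≤a
        0<b = ℚₚ.<-≤-trans 0<δ δ≤b
    in begin
    ℚ.∣ recip a ℚ.- recip b ∣
      ≡⟨ dist-recip 0<a 0<b ⟩
    ℚ.∣ b ℚ.- a ∣ ℚ.* (recip a ℚ.* recip b)
      ≤⟨ mul-mono-≤ (ℚₚ.0≤∣p∣ (b ℚ.- a))
           (h n m (ℕₚ.m⊔n≤o⇒n≤o M N N≤n) (ℕₚ.m⊔n≤o⇒n≤o M N N≤m))
           (ℚₚ.<⇒≤ (mul-pos (recip-pos 0<a) (recip-pos 0<b)))
           (mul-mono-≤ (ℚₚ.<⇒≤ (recip-pos 0<a)) (recip-mono 0<δ δ≤a)
                       (ℚₚ.<⇒≤ (recip-pos 0<b)) (recip-mono 0<δ δ≤b)) ⟩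
    ε ℚ.* (δ ℚ.* δ) ℚ.* (r ℚ.* r)
      ≡⟨ solve 3 (λ e d r → e :* (d :* d) :* (r :* r) := e :* ((d :* r) :* (d :* r))) refl ε δ r ⟩
    ε ℚ.* ((δ ℚ.* r) ℚ.* (δ ℚ.* r))
      ≡⟨ cong (λ z → ε ℚ.* (z ℚ.* z)) (recip-inverse 0<δ) ⟩
    ε ℚ.* 1ℚ
      ≡⟨ ℚₚ.*-identityʳ ε ⟩
    ε ∎
  where open ℚₚ.≤-Reasoning
        open +-*-Solver

infix 9 √_

-- Negative approximations are replaced by 0, which does not matter for the
-- limit when x ≥ 0.
√_ : ℝ → ℝ
√ x = mkℝ (λ n → root (0ℚ ℚ.⊔ seq x n) n) λ ε 0<ε →
  let η = (½ ℚ.* ε) ℚ.* (½ ℚ.* ε)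
      0<η = mul-pos (half-pos 0<ε) (half-pos 0<ε)
      M , hu = unit-small (half-pos 0<ε)
      N , hx = cauchy x η 0<η
      bound = λ m n M≤n N≤m N≤n → root-≤ {ε = ε} m n
        (ℚₚ.p≤p⊔q 0ℚ (seq x m)) (ℚₚ.p≤p⊔q 0ℚ (seq x n)) (ℚₚ.<⇒≤ 0<ε)
        (0⊔-≤ {seq x m} {seq x n} (ℚₚ.<⇒≤ 0<η)
          (ℚₚ.≤-trans (≤+dist (seq x m) (seq x n)) (ℚₚ.+-monoʳ-≤ (seq x n) (hx m n N≤m N≤n))))
        (hu n M≤n)
  in M ℕ.⊔ N , λ m n K≤m K≤n →
    let M≤m = ℕₚ.m⊔n≤o⇒m≤o M N K≤m
        M≤n = ℕₚ.m⊔n≤o⇒m≤o M N K≤n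
        N≤m = ℕₚ.m⊔n≤o⇒n≤o M N K≤m
        N≤n = ℕₚ.m⊔n≤o⇒n≤o M N K≤n
    in dist-≤ (bound m n M≤n N≤m N≤n) (bound n m M≤m N≤n N≤m)

⁻¹-inverse : ∀ x (0<x : 0ℝ < x) → x * x ⁻¹⟨ 0<x ⟩ ≃ 1ℝ
⁻¹-inverse x 0<x =
    (λ ε 0<ε → M , λ n M≤n → subst (ℚ._≤ 1ℚ ℚ.+ ε) (sym (eq n M≤n)) (1≤1+ε 0<ε))
  , (λ ε 0<ε → M , λ n M≤n → subst (λ z → 1ℚ ℚ.≤ z ℚ.+ ε) (sym (eq n M≤n)) (1≤1+ε 0<ε))
  where
  bound = <⇒eventually-≥ {x} 0<x
  M = proj₁ (proj₂ (proj₂ bound))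
  eq : ∀ n → M ℕ.≤ n → seq x n ℚ.* recip (seq x n) ≡ 1ℚ
  eq n M≤n = recip-inverse (ℚₚ.<-≤-trans (proj₁ (proj₂ bound)) (proj₂ (proj₂ (proj₂ bound)) n M≤n))
  1≤1+ε : ∀ {ε} → 0ℚ ℚ.< ε → 1ℚ ℚ.≤ 1ℚ ℚ.+ ε
  1≤1+ε 0<ε = ℚₚ.+-monoʳ-≤ 1ℚ (ℚₚ.<⇒≤ 0<ε)

√-nonneg : ∀ x → 0ℝ ≤ √ x
√-nonneg x ε 0<ε = 0 , λ n _ → ℚₚ.+-mono-≤ (root-nonneg (0ℚ ℚ.⊔ seq x n) n) (ℚₚ.<⇒≤ 0<ε)

√-square : ∀ x → 0ℝ ≤ x → √ x * √ x ≃ x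
√-square x 0≤x =
    (λ ε 0<ε → let N , h = 0≤x ε 0<ε in N , λ n N≤n → begin
      r n ℚ.* r n        ≤⟨ root-lower n (0≤a n) ⟩
      0ℚ ℚ.⊔ seq x n     ≤⟨ ℚₚ.⊔-lub {seq x n ℚ.+ ε} {0ℚ} (h n N≤n) (x≤x+ε (seq x n) 0<ε) ⟩
      seq x n ℚ.+ ε      ∎)
  , (λ ε 0<ε →
      let B , 0<B , M , hB = eventually-bounded (√ x)
          C    = B ℚ.+ B ℚ.+ 1ℚ
          0<C  = ℚₚ.+-mono-< (ℚₚ.+-mono-< 0<B 0<B) 0<1
          δ    = ε ℚ.* recip C
          0<δ  = mul-pos 0<ε (recip-pos 0<C)
          N , hδ = unit-small 0<δ
          K , h1 = unit-small 0<1
      in M ℕ.⊔ (N ℕ.⊔ K) , λ n ≤n →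
        let M≤n = ℕₚ.m⊔n≤o⇒m≤o M (N ℕ.⊔ K) ≤n
            N≤n = ℕₚ.m⊔n≤o⇒m≤o N K (ℕₚ.m⊔n≤o⇒n≤o M (N ℕ.⊔ K) ≤n)
            K≤n = ℕₚ.m⊔n≤o⇒n≤o N K (ℕₚ.m⊔n≤o⇒n≤o M (N ℕ.⊔ K) ≤n)
            s = r n
            u = unit n
            0≤s = root-nonneg (0ℚ ℚ.⊔ seq x n) n
            0≤u = ℚₚ.<⇒≤ (unit-pos n)
            s≤B = ℚₚ.≤-trans (≤∣∣ s) (hB n M≤n)
        in begin
        seq x n                            ≤⟨ ℚₚ.p≤q⊔p 0ℚ (seq x n) ⟩
        0ℚ ℚ.⊔ seq x n                     ≤⟨ ℚₚ.<⇒≤ (root-upper n (0≤a n)) ⟩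
        (s ℚ.+ u) ℚ.* (s ℚ.+ u)            ≡⟨ solve 2 (λ s u → (s :+ u) :* (s :+ u) := s :* s :+ u :* (s :+ s :+ u)) refl s u ⟩
        s ℚ.* s ℚ.+ u ℚ.* (s ℚ.+ s ℚ.+ u)  ≤⟨ ℚₚ.+-monoʳ-≤ (s ℚ.* s)
                                                (mul-mono-≤ 0≤u (hδ n N≤n) (ℚₚ.+-mono-≤ (ℚₚ.+-mono-≤ 0≤s 0≤s) 0≤u)
                                                  (ℚₚ.+-mono-≤ (ℚₚ.+-mono-≤ s≤B s≤B) (h1 n K≤n))) ⟩
        s ℚ.* s ℚ.+ δ ℚ.* C                ≡⟨ cong (s ℚ.* s ℚ.+_) (trans
                                                (solve 3 (λ e i c → e :* i :* c := e :* (c :* i)) refl ε (recip C) C)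
                                                (trans (cong (ε ℚ.*_) (recip-inverse 0<C)) (ℚₚ.*-identityʳ ε))) ⟩
        s ℚ.* s ℚ.+ ε                      ∎)
  where
  open ℚₚ.≤-Reasoning
  open +-*-Solver
  r : ℕ → ℚ
  r n = root (0ℚ ℚ.⊔ seq x n) n
  0≤a : ∀ n → 0ℚ ℚ.≤ 0ℚ ℚ.⊔ seq x n
  0≤a n = ℚₚ.p≤p⊔q 0ℚ (seq x n)
  x≤x+ε : ∀ p {ε} → 0ℚ ℚ.< ε → p ℚ.≤ p ℚ.+ ε
  x≤x+ε p {ε} 0<ε = subst (ℚ._≤ p ℚ.+ ε) (ℚₚ.+-identityʳ p) (ℚₚ.+-monoʳ-≤ p (ℚₚ.<⇒≤ 0<ε))

1≤⇒0< : ∀ {x} → 1ℝ ≤ x → 0ℝ < x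
1≤⇒0< {x} 1≤x = let N , h = 1≤x ½ (ℚₚ.positive⁻¹ ½) in
  ½ , ℚₚ.positive⁻¹ ½ , N , λ n N≤n →
    subst (½ ℚ.≤_) (solve 1 (λ a → a :+ con ½ :- con ½ := a) refl (seq x n))
      (ℚₚ.+-monoˡ-≤ (ℚ.- ½) (h n N≤n))
  where open +-*-Solver

<⇒≤ : ∀ {x y} → x < y → x ≤ y
<⇒≤ {x} {y} (δ , 0<δ , N , h) ε 0<ε = N , λ n N≤n → begin
  seq x n         ≡⟨ sym (ℚₚ.+-identityʳ (seq x n)) ⟩
  seq x n ℚ.+ 0ℚ  ≤⟨ ℚₚ.+-monoʳ-≤ (seq x n) (ℚₚ.<⇒≤ 0<δ) ⟩
  seq x n ℚ.+ δ   ≤⟨ h n N≤n ⟩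
  seq y n         ≡⟨ sym (ℚₚ.+-identityʳ (seq y n)) ⟩
  seq y n ℚ.+ 0ℚ  ≤⟨ ℚₚ.+-monoʳ-≤ (seq y n) (ℚₚ.<⇒≤ 0<ε) ⟩
  seq y n ℚ.+ ε   ∎
  where open ℚₚ.≤-Reasoning

<-minus-swap : ∀ {x y z} → x < y - z → z < y - x
<-minus-swap {x} {y} {z} (δ , 0<δ , N , h) = δ , 0<δ , N , λ n N≤n →
  let a = seq x n ; b = seq y n ; c = seq z n in
  subst₂ ℚ._≤_
    (solve 3 (λ a c d → a :+ d :+ (c :- a) := c :+ d) refl a c δ)
    (solve 3 (λ a b c → b :- c :+ (c :- a) := b :- a) refl a b c)
    (ℚₚ.+-monoˡ-≤ (c ℚ.- a) (h n N≤n))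
  where open +-*-Solver

-- A random experiment with finitely many stages, each drawing a uniformly
-- distributed element of Fin (suc m) for some m.
data Experiment (A : Set) : Set where
  return  : A → Experiment A
  uniform : (m : ℕ) → (Fin (suc m) → Experiment A) → Experiment A

module _ {A : Set} where

  Outcome : Experiment A → Set
  Outcome (return _)    = ⊤
  Outcome (uniform m k) = Σ (Fin (suc m)) λ i → Outcome (k i)

  value : (e : Experiment A) → Outcome e → A
  value (return x)    _       = x
  value (uniform m k) (i , ω) = value (k i) ω

  Event : Experiment A → Set
  Event e = Outcome e → Bool

  probability : (e : Experiment A) → Event e → ℚ
  probability (return _)    E = if E tt then 1ℚ else 0ℚ
  probability (uniform m k) E =
    (+ 1 ℚ./ suc m) ℚ.* sum ℚₚ.+-0-commutativeMonoid λ i → probability (k i) λ ω → E (i , ω)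

  -- P need not be decidable, so its probability is bounded from below by that
  -- of an event contained in it.
  ProbabilityAtLeast : ℚ → (A → Set) → Experiment A → Set
  ProbabilityAtLeast p P e =
    ∃[ E ] (∀ ω → E ω ≡ true → P (value e ω)) × p ℚ.≤ probability e E

data Action (n : ℕ) (State : Set) : Set where
  halt    : ℝ → Action n State
  compute : State → Action n State
  read    : Fin n → (ℝ → State) → Action n State

-- One unit of time consists of drawing a uniformly distributed element of
-- Fin (suc (draws s)), where s is the current state, and acting on it.  Thus
-- an item is read at a chosen position or, taking suc (draws s) = n, at a
-- uniformly random one.  Halting takes no time.  Nothing forces a machine to
-- halt.
record Machine (n : ℕ) : Set₁ where
  field
    State : Set
    start : State
    draws : State → ℕ
    act   : (s : State) → Fin (suc (draws s)) → Action n State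

module _ {n : ℕ} (M : Machine n) (a : Vec ℝ n) where
  open Machine M

  -- nothing means that the machine has not halted within t units of time.
  runFrom : (t : ℕ) → State → Experiment (Maybe ℝ)
  perform : (t : ℕ) → Action n State → Experiment (Maybe ℝ)

  runFrom t s = uniform (draws s) λ i → perform t (act s i)

  perform t       (halt x)    = return (just x)
  perform zero    (compute _) = return nothing
  perform zero    (read _ _)  = return nothing
  perform (suc t) (compute s) = runFrom t s
  perform (suc t) (read i k)  = runFrom t (k (lookup a i))

  run : ℕ → Experiment (Maybe ℝ)
  run t = runFrom t start

  -- The probability of halting with an output in P is the supremum over t of
  -- that of doing so within t units of time.
  OutputProbabilityAtLeast : ℚ → (ℝ → Set) → Set
  OutputProbabilityAtLeast p P =
    ∀ q → q ℚ.< p → ∃[ t ] ProbabilityAtLeast q (Maybe.Any P) (run t)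

  CanRunLongerThan : ℕ → Set
  CanRunLongerThan t = ∃[ ω ] value (run t) ω ≡ nothing

-- The supremum of the running times over all inputs in C and all random
-- choices, a natural number or infinity, is at least x.
WorstCaseTimeAtLeast : ∀ {n} → ℝ → (Vec ℝ n → Set) → Machine n → Set
WorstCaseTimeAtLeast x C M =
  ∀ t → fromℕ t < x → ∃[ a ] C a × CanRunLongerThan M a t

total : ∀ {n} → Vec ℝ n → ℝ
total = foldr′ _+_ 0ℝ

IsApproximation : (k : ℝ) → 1ℝ ≤ k → ∀ {n} → Vec ℝ n → ℝ → Set
IsApproximation k 1≤k a s = k ⁻¹⟨ 1≤⇒0< {k} 1≤k ⟩ * total a ≤ s × s ≤ k * total a

SumProblem : (c : ℝ) → 1ℝ < c → (ℕ → ℕ) → ∀ n → Vec ℝ n → Set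
SumProblem c 1<c f n a =
  All (0ℝ ≤_) a ×
  fromℕ (f n) * c ⁻¹⟨ 1≤⇒0< {c} (<⇒≤ {1ℝ} {c} 1<c) ⟩ ≤ total a ×
  total a ≤ c * fromℕ (f n)

IsApproximationAlgorithm : (k : ℝ) → 1ℝ ≤ k → (∀ n → Vec ℝ n → Set) →
                           (∀ n → Machine n) → Set
IsApproximationAlgorithm k 1≤k C A = ∀ n a → C n a →
  OutputProbabilityAtLeast (A n) a (+ 3 ℚ./ 4) (IsApproximation k 1≤k a)

-- n / f n is meaningless only when f n = 0, which is excluded for large n
-- whenever f is nondecreasing and unbounded.
Needs-Ω[n/_] : (ℕ → ℕ) → (∀ n → Vec ℝ n → Set) → (∀ n → Machine n) → Set
Needs-Ω[n/ f ] C A = ∃[ κ ] 0ℝ < κ × (∃[ N ] ∀ n → N ℕ.≤ n → .{{_ : ℕ.NonZero (f n)}} →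
  WorstCaseTimeAtLeast (κ * fromℚ (+ n ℚ./ f n)) (C n) (A n))

Nondecreasing : (ℕ → ℕ) → Set
Nondecreasing f = ∀ {m n} → m ℕ.≤ n → f m ℕ.≤ f n

Unbounded : (ℕ → ℕ) → Set
Unbounded f = ∀ B → ∃[ n ] B ℕ.< f n

IsLittleO[n] : (ℕ → ℕ) → Set
IsLittleO[n] f = ∀ δ → 0ℝ < δ → ∃[ N ] ∀ n → N ℕ.≤ n → fromℕ (f n) ≤ δ * fromℕ n

{-# OPTIONS --safe #-}
module Submission where

-- A needle in a haystack: let one item equal f(n) and all others 0, so that the
-- sum is f(n), and consider the n inputs obtained by adding (c − 1) f(n) at a
-- single position, whose sum is c f(n).  Since k = √c − ε satisfies k² < c, no
-- output is a k-approximation for both sums.  Couple the run on the first input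
-- with that on the input changed at j by sharing the random choices: both
-- succeed only if position j is read, so the expected number of reads at j is at
-- least 1/4 for each j, whereas t steps make at most t reads.

open import Algebra.Bundles using (CommutativeRing)
import Algebra.Properties.Semiring.Sum
open import Data.Bool.Base using (true; false; if_then_else_)
open import Data.Empty using (⊥; ⊥-elim)
open import Data.Fin.Base using (Fin; zero; suc)
open import Data.Fin.Properties using (_≟_; any?)
open import Data.Integer.Base as ℤ using (+_)
import Data.Integer.Properties as ℤₚ
open import Data.Maybe.Base using (Maybe; just; nothing)
import Data.Maybe.Relation.Unary.Any as Maybe
open import Data.Nat.Base as ℕ using (ℕ; zero; suc)
import Data.Nat.Properties as ℕₚ
open import Data.Product.Base using (∃-syntax; _×_; _,_; proj₁; proj₂)
open import Data.Rational.Base as ℚ using (ℚ; 0ℚ; 1ℚ; ½)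
import Data.Rational.Properties as ℚₚ
open import Data.Rational.Solver using (module +-*-Solver)
import Data.Rational.Unnormalised.Base as ℚᵘ
import Data.Rational.Unnormalised.Properties as ℚᵘₚ
open import Data.Unit.Base using (tt)
open import Data.Vec.Base using (Vec; []; _∷_; lookup; updateAt; replicate)
open import Data.Vec.Properties using (lookup∘updateAt′)
open import Data.Vec.Relation.Unary.All using (All; []; _∷_)
open import Function.Base using (_∘_; const)
open import Relation.Binary.PropositionalEquality
open import Relation.Nullary using (Dec; yes; no; does; contradiction)
open import Relation.Nullary.Decidable using (map′; toWitness; decidable-stable)

open import Defs using (module RationalLemmas)

open RationalLemmas
open Algebra.Properties.Semiring.Sum (CommutativeRing.semiring ℚₚ.+-*-commutativeRing)
  using (sum; sum-replicate-zero; ∑-distrib-+; ∑-comm; *-distribˡ-sum)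

-- Sums and means of rationals, and the gap between the two approximation ranges.

module RationalMeans where
  open import Data.Rational.Base

  fromℕ-suc : ∀ n → + suc n / 1 ≡ 1ℚ + + n / 1
  fromℕ-suc n = trans (grid-suc 0 n) (ℚₚ.+-comm (+ n / 1) 1ℚ)

  sum-const : ∀ n x → sum {n} (const x) ≡ + n / 1 * x
  sum-const zero    x = sym (ℚₚ.*-zeroˡ x)
  sum-const (suc n) x = begin
    x + sum {n} (const x)    ≡⟨ cong₂ _+_ (sym (ℚₚ.*-identityˡ x)) (sum-const n x) ⟩
    1ℚ * x + + n / 1 * x     ≡⟨ ℚₚ.*-distribʳ-+ x 1ℚ (+ n / 1) ⟨
    (1ℚ + + n / 1) * x       ≡⟨ cong (_* x) (fromℕ-suc n) ⟨
    + suc n / 1 * x          ∎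
    where open ≡-Reasoning

  sum-mono-≤ : ∀ {n} {f g : Fin n → ℚ} → (∀ i → f i ≤ g i) → sum f ≤ sum g
  sum-mono-≤ {zero}  f≤g = ℚₚ.≤-refl
  sum-mono-≤ {suc n} f≤g = ℚₚ.+-mono-≤ (f≤g zero) (sum-mono-≤ (f≤g ∘ suc))

  -- Agrees by definition with the average that `probability` takes at a `uniform` stage, so the
  -- laws of means apply to probabilities directly.
  mean : ∀ {m} → (Fin (suc m) → ℚ) → ℚ
  mean {m} f = unit m * sum f

  unit*suc : ∀ m → unit m * (+ suc m / 1) ≡ 1ℚ
  unit*suc m = ℚₚ.toℚᵘ-injective (begin
    toℚᵘ (unit m * (+ suc m / 1))               ≈⟨ ℚₚ.toℚᵘ-homo-* (unit m) (+ suc m / 1) ⟩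
    toℚᵘ (unit m) ℚᵘ.* toℚᵘ (+ suc m / 1)       ≈⟨ ℚᵘₚ.*-cong (toℚᵘ-/ (+ 1) m) (toℚᵘ-/ (+ suc m) 0) ⟩
    ℚᵘ.mkℚᵘ (+ 1) m ℚᵘ.* ℚᵘ.mkℚᵘ (+ suc m) 0    ≈⟨ ℚᵘ.*≡* (cong +_ (ℕₚ.*-assoc 1 (suc m) 1)) ⟩
    toℚᵘ 1ℚ                                     ∎)
    where open ℚᵘₚ.≃-Reasoning

  mean-const : ∀ m x → mean {m} (const x) ≡ x
  mean-const m x = begin
    unit m * sum {suc m} (const x)  ≡⟨ cong (unit m *_) (sum-const (suc m) x) ⟩
    unit m * (+ suc m / 1 * x)      ≡⟨ ℚₚ.*-assoc (unit m) (+ suc m / 1) x ⟨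
    unit m * (+ suc m / 1) * x      ≡⟨ cong (_* x) (unit*suc m) ⟩
    1ℚ * x                          ≡⟨ ℚₚ.*-identityˡ x ⟩
    x                               ∎
    where open ≡-Reasoning

  mean-+ : ∀ {m} (f g : Fin (suc m) → ℚ) → mean (λ i → f i + g i) ≡ mean f + mean g
  mean-+ {m} f g = trans (cong (unit m *_) (∑-distrib-+ f g)) (ℚₚ.*-distribˡ-+ (unit m) (sum f) (sum g))

  mean-mono-≤ : ∀ {m} {f g : Fin (suc m) → ℚ} → (∀ i → f i ≤ g i) → mean f ≤ mean g
  mean-mono-≤ {m} f≤g =
    ℚₚ.*-monoˡ-≤-nonNeg (unit m) {{nonNegative (ℚₚ.<⇒≤ (unit-pos m))}} (sum-mono-≤ f≤g)

  mean-≤ : ∀ {m} {f : Fin (suc m) → ℚ} x → (∀ i → f i ≤ x) → mean f ≤ x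
  mean-≤ {m} {f} x f≤x = subst (mean f ≤_) (mean-const m x) (mean-mono-≤ f≤x)

  mean-≥ : ∀ {m} {f : Fin (suc m) → ℚ} x → (∀ i → x ≤ f i) → x ≤ mean f
  mean-≥ {m} {f} x x≤f = subst (_≤ mean f) (mean-const m x) (mean-mono-≤ x≤f)

  -- Linearity of expectation: lets the expected reads, summed over all positions, be bounded
  -- separately for each draw.
  sum-mean : ∀ {m n} (f : Fin (suc m) → Fin n → ℚ) →
             sum (λ j → mean (λ i → f i j)) ≡ mean (λ i → sum (f i))
  sum-mean {m} f = trans
    (sym (*-distribˡ-sum (unit m) (λ j → sum (λ i → f i j))))
    (cong (unit m *_) (sym (∑-comm f)))

  -- Going through `does` makes `indicator (suc i) (suc j)` reduce to `indicator i j`.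
  indicator : ∀ {n} → Fin n → Fin n → ℚ
  indicator i j = if does (i ≟ j) then 1ℚ else 0ℚ

  indicator-nonneg : ∀ {n} (i j : Fin n) → 0ℚ ≤ indicator i j
  indicator-nonneg i j with does (i ≟ j)
  ... | true  = ℚₚ.<⇒≤ 0<1
  ... | false = ℚₚ.≤-refl

  sum-indicator : ∀ {n} (i : Fin n) → sum (indicator i) ≡ 1ℚ
  sum-indicator {suc n} zero    = cong (λ z → 1ℚ + z) (sum-replicate-zero n)
  sum-indicator {suc n} (suc i) = trans (ℚₚ.+-identityˡ _) (sum-indicator i)

  -- Dividing c ≥ (k + e)² ≥ k² + 2ke by k gives c/k ≥ k + 2e.
  scaled-gap : ∀ {c k r e F : ℚ} → 0ℚ < k → 0ℚ ≤ e → k + e ≤ r → r * r ≤ c → 1ℚ ≤ F →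
               k * F + (e + e) ≤ recip k * (c * F)
  scaled-gap {c} {k} {r} {e} {F} 0<k 0≤e k+e≤r r²≤c 1≤F = begin
    k * F + (e + e)                        ≡⟨ cong (λ z → k * F + z) (sym (ℚₚ.*-identityʳ (e + e))) ⟩
    k * F + (e + e) * 1ℚ                   ≤⟨ ℚₚ.+-monoʳ-≤ (k * F) (mul-mono-≤ (ℚₚ.+-mono-≤ 0≤e 0≤e) ℚₚ.≤-refl 0≤1 1≤F) ⟩
    k * F + (e + e) * F                    ≡⟨ solve 3 (λ k e f → k :* f :+ (e :+ e) :* f := con 1ℚ :* (k :+ (e :+ e)) :* f) refl k e F ⟩
    1ℚ * (k + (e + e)) * F                 ≡⟨ cong (λ z → z * (k + (e + e)) * F) (recip-inverse 0<k) ⟨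
    k * recip k * (k + (e + e)) * F        ≡⟨ solve 4 (λ k i e f → k :* i :* (k :+ (e :+ e)) :* f := i :* ((k :* k :+ k :* (e :+ e)) :* f)) refl k (recip k) e F ⟩
    recip k * ((k * k + k * (e + e)) * F)  ≤⟨ mul-mono-≤ 0≤1/k ℚₚ.≤-refl (mul-nonneg 0≤q 0≤F) (mul-mono-≤ 0≤q q≤c 0≤F ℚₚ.≤-refl) ⟩
    recip k * (c * F)                      ∎
    where
    open ℚₚ.≤-Reasoning
    open +-*-Solver
    0≤1   = ℚₚ.<⇒≤ 0<1
    0≤F   = ℚₚ.≤-trans 0≤1 1≤F
    0≤k   = ℚₚ.<⇒≤ 0<k
    0≤1/k = ℚₚ.<⇒≤ (recip-pos 0<k)
    0≤k+e = ℚₚ.+-mono-≤ 0≤k 0≤e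
    0≤q   = ℚₚ.+-mono-≤ (mul-nonneg 0≤k 0≤k) (mul-nonneg 0≤k (ℚₚ.+-mono-≤ 0≤e 0≤e))
    q≤c : k * k + k * (e + e) ≤ c
    q≤c = begin
      k * k + k * (e + e)          ≡⟨ ℚₚ.+-identityʳ _ ⟨
      k * k + k * (e + e) + 0ℚ     ≤⟨ ℚₚ.+-monoʳ-≤ (k * k + k * (e + e)) (mul-nonneg 0≤e 0≤e) ⟩
      k * k + k * (e + e) + e * e  ≡⟨ solve 2 (λ k e → k :* k :+ k :* (e :+ e) :+ e :* e := (k :+ e) :* (k :+ e)) refl k e ⟩
      (k + e) * (k + e)            ≤⟨ mul-mono-≤ 0≤k+e k+e≤r 0≤k+e k+e≤r ⟩
      r * r                        ≤⟨ r²≤c ⟩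
      c                            ∎

  -- An output meets each bound up to a slack of `½ * e`, so `e` in total, while by `scaled-gap` the
  -- bounds lie at least `e + e` apart.
  gap-contradiction : ∀ {c k r e F s : ℚ} → 0ℚ < k → 0ℚ < e → k + e ≤ r → r * r ≤ c → 1ℚ ≤ F →
                      s ≤ k * F + ½ * e → recip k * (c * F) ≤ s + ½ * e → ⊥
  gap-contradiction {c} {k} {r} {e} {F} {s} 0<k 0<e k+e≤r r²≤c 1≤F upper lower =
    ℚₚ.<-irrefl refl (begin-strict
      k * F + e                  ≡⟨ cong (λ z → k * F + z) (ℚₚ.+-identityˡ e) ⟨
      k * F + (0ℚ + e)           <⟨ ℚₚ.+-monoʳ-< (k * F) (ℚₚ.+-monoˡ-< e 0<e) ⟩
      k * F + (e + e)            ≤⟨ scaled-gap 0<k (ℚₚ.<⇒≤ 0<e) k+e≤r r²≤c 1≤F ⟩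
      recip k * (c * F)          ≤⟨ lower ⟩
      s + ½ * e                  ≤⟨ ℚₚ.+-monoˡ-≤ (½ * e) upper ⟩
      k * F + ½ * e + ½ * e      ≡⟨ ℚₚ.+-assoc (k * F) (½ * e) (½ * e) ⟩
      k * F + (½ * e + ½ * e)    ≡⟨ cong (λ z → k * F + z) (half+half e) ⟩
      k * F + e                  ∎)
    where open ℚₚ.≤-Reasoning

open RationalMeans

open import Defs

-- Timeouts and success events of experiments.

module _ {A : Set} where

  CanTimeOut : Experiment (Maybe A) → Set
  CanTimeOut e = ∃[ ω ] value e ω ≡ nothing

  -- There are finitely many outcomes to search. Decidability allows the existence of a long run to
  -- be proved by contradiction.
  canTimeOut? : ∀ e → Dec (CanTimeOut e)
  canTimeOut? (return nothing)  = yes (tt , refl)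
  canTimeOut? (return (just x)) = no λ ()
  canTimeOut? (uniform m k)     = map′
    (λ (i , ω , eq) → (i , ω) , eq) (λ ((i , ω) , eq) → i , ω , eq)
    (any? λ i → canTimeOut? (k i))

  probability-≤1 : ∀ (e : Experiment A) E → probability e E ℚ.≤ 1ℚ
  probability-≤1 (return _) E with E tt
  ... | true  = ℚₚ.≤-refl
  ... | false = ℚₚ.<⇒≤ 0<1
  probability-≤1 (uniform m k) E = mean-≤ 1ℚ λ i → probability-≤1 (k i) λ ω → E (i , ω)

  Within : (A → Set) → (e : Experiment A) → Event e → Set
  Within P e E = ∀ ω → E ω ≡ true → P (value e ω)

module _ {A : Set} {P : A → Set} where

  probability-nothing : ∀ {E} → Within (Maybe.Any P) (return nothing) E →
                        probability {Maybe A} (return nothing) E ≡ 0ℚ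
  probability-nothing {E} within with E tt in eq
  ... | false = refl
  ... | true with () ← within tt eq

module _ {A : Set} {P Q : A → Set} (disjoint : ∀ {x} → P x → Q x → ⊥) where

  -- A single output `x` cannot satisfy both `P` and `Q`, so at most one of the two events holds.
  -- This is where disjointness enters the coupling.
  probability-disjoint : ∀ {x E G} → Within (Maybe.Any P) (return (just x)) E →
    Within (Maybe.Any Q) (return (just x)) G →
    probability (return (just x)) E ℚ.+ probability (return (just x)) G ℚ.≤ 1ℚ
  probability-disjoint {E = E} {G} p q with E tt in eqE | G tt in eqG
  ... | true  | false = ℚₚ.≤-refl
  ... | false | true  = ℚₚ.≤-refl
  ... | false | false = ℚₚ.<⇒≤ 0<1
  ... | true  | true with Maybe.just px ← p tt eqE | Maybe.just qx ← q tt eqG =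
    ⊥-elim (disjoint px qx)

-- Expected numbers of reads.

module _ {n} (M : Machine n) (a : Vec ℝ n) where
  open Machine M

  -- The expected number of reads at position j within t units of time.
  readsFrom : ℕ → State → Fin n → ℚ
  readsBy   : ℕ → Action n State → Fin n → ℚ

  readsFrom t s j = mean λ i → readsBy t (act s i) j

  readsBy t       (halt _)    j = 0ℚ
  readsBy zero    (compute _) j = 0ℚ
  readsBy zero    (read _ _)  j = 0ℚ
  readsBy (suc t) (compute s) j = readsFrom t s j
  readsBy (suc t) (read i k)  j = indicator i j ℚ.+ readsFrom t (k (lookup a i)) j

  readsFrom-nonneg : ∀ t s j → 0ℚ ℚ.≤ readsFrom t s j
  readsBy-nonneg   : ∀ t α j → 0ℚ ℚ.≤ readsBy t α j

  readsFrom-nonneg t s j = mean-≥ 0ℚ λ i → readsBy-nonneg t (act s i) j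

  readsBy-nonneg t       (halt _)    j = ℚₚ.≤-refl
  readsBy-nonneg zero    (compute _) j = ℚₚ.≤-refl
  readsBy-nonneg zero    (read _ _)  j = ℚₚ.≤-refl
  readsBy-nonneg (suc t) (compute s) j = readsFrom-nonneg t s j
  readsBy-nonneg (suc t) (read i k)  j =
    ℚₚ.+-mono-≤ (indicator-nonneg i j) (readsFrom-nonneg t (k (lookup a i)) j)

  -- A unit of time reads at most one position, and that read has total weight 1 by `sum-indicator`.
  -- With no time left an action is still drawn, but a read is not carried out, so the bound is `t`
  -- and not `t + 1`.
  sum-readsFrom : ∀ t s → sum (readsFrom t s) ℚ.≤ + t ℚ./ 1
  sum-readsBy   : ∀ t α → sum (readsBy t α) ℚ.≤ + t ℚ./ 1

  sum-readsFrom t s = subst (ℚ._≤ + t ℚ./ 1)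
    (sym (sum-mean λ i → readsBy t (act s i)))
    (mean-≤ (+ t ℚ./ 1) λ i → sum-readsBy t (act s i))

  sum-readsBy t       (halt _)    = subst (ℚ._≤ + t ℚ./ 1) (sym (sum-replicate-zero n)) (grid-nonneg 0 t)
  sum-readsBy zero    (compute _) = ℚₚ.≤-reflexive (sum-replicate-zero n)
  sum-readsBy zero    (read _ _)  = ℚₚ.≤-reflexive (sum-replicate-zero n)
  sum-readsBy (suc t) (compute s) = begin
    sum (readsFrom t s)  ≤⟨ sum-readsFrom t s ⟩
    + t ℚ./ 1            ≡⟨ ℚₚ.+-identityˡ (+ t ℚ./ 1) ⟨
    0ℚ ℚ.+ + t ℚ./ 1     ≤⟨ ℚₚ.+-monoˡ-≤ (+ t ℚ./ 1) (ℚₚ.<⇒≤ 0<1) ⟩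
    1ℚ ℚ.+ + t ℚ./ 1     ≡⟨ fromℕ-suc t ⟨
    + suc t ℚ./ 1        ∎
    where open ℚₚ.≤-Reasoning
  sum-readsBy (suc t) (read i k) = begin
    sum (λ j → indicator i j ℚ.+ readsFrom t s′ j)  ≡⟨ ∑-distrib-+ (indicator i) (readsFrom t s′) ⟩
    sum (indicator i) ℚ.+ sum (readsFrom t s′)      ≤⟨ ℚₚ.+-mono-≤ (ℚₚ.≤-reflexive (sum-indicator i)) (sum-readsFrom t s′) ⟩
    1ℚ ℚ.+ + t ℚ./ 1                                ≡⟨ fromℕ-suc t ⟨
    + suc t ℚ./ 1                                   ∎
    where open ℚₚ.≤-Reasoning
          s′ = k (lookup a i)

-- Coupling the runs on two inputs.

-- With shared random choices, the runs on two inputs that differ only at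
-- position j agree until j is read.  Since the run on a always halts within time t,
-- there are no later reads to account for, however long the times T and U are at
-- which the two runs are observed.
module Coupling {n} (M : Machine n) (a b : Vec ℝ n) (j : Fin n)
  (agree : ∀ i → i ≢ j → lookup b i ≡ lookup a i)
  {P Q : ℝ → Set} (disjoint : ∀ {x} → P x → Q x → ⊥) where
  open Machine M

  1≤1+ : ∀ {x} → 0ℚ ℚ.≤ x → 1ℚ ℚ.≤ 1ℚ ℚ.+ x
  1≤1+ = ℚₚ.+-monoʳ-≤ 1ℚ

  runFrom-coupling : ∀ t T U s → (∀ ω → value (runFrom M a t s) ω ≢ nothing) → ∀ E G →
    Within (Maybe.Any P) (runFrom M a T s) E → Within (Maybe.Any Q) (runFrom M b U s) G →
    probability (runFrom M a T s) E ℚ.+ probability (runFrom M b U s) G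
      ℚ.≤ 1ℚ ℚ.+ readsFrom M a t s j

  perform-coupling : ∀ t T U α → (∀ ω → value (perform M a t α) ω ≢ nothing) → ∀ E G →
    Within (Maybe.Any P) (perform M a T α) E → Within (Maybe.Any Q) (perform M b U α) G →
    probability (perform M a T α) E ℚ.+ probability (perform M b U α) G
      ℚ.≤ 1ℚ ℚ.+ readsBy M a t α j

  -- A timed-out run never succeeds, which leaves only the other probability. The local `P` shadows
  -- that of the module so that `nothing-right` can use this with `Q`.
  nothing-left : ∀ {P : ℝ → Set} (e : Experiment (Maybe ℝ)) E G {x} →
    Within (Maybe.Any P) (return nothing) E → 0ℚ ℚ.≤ x →
    probability {Maybe ℝ} (return nothing) E ℚ.+ probability e G ℚ.≤ 1ℚ ℚ.+ x
  nothing-left {P} e E G {x} p 0≤x = begin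
    probability {Maybe ℝ} (return nothing) E ℚ.+ probability e G  ≡⟨ cong (λ z → z ℚ.+ probability e G) (probability-nothing {P = P} {E} p) ⟩
    0ℚ ℚ.+ probability e G                                        ≡⟨ ℚₚ.+-identityˡ _ ⟩
    probability e G                                               ≤⟨ probability-≤1 e G ⟩
    1ℚ                                                            ≤⟨ 1≤1+ 0≤x ⟩
    1ℚ ℚ.+ x                                                      ∎
    where open ℚₚ.≤-Reasoning

  nothing-right : ∀ (e : Experiment (Maybe ℝ)) E G {x} →
    Within (Maybe.Any Q) (return nothing) G → 0ℚ ℚ.≤ x →
    probability e E ℚ.+ probability {Maybe ℝ} (return nothing) G ℚ.≤ 1ℚ ℚ.+ x
  nothing-right e E G {x} q 0≤x = subst (ℚ._≤ 1ℚ ℚ.+ x)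
    (ℚₚ.+-comm (probability {Maybe ℝ} (return nothing) G) (probability e E))
    (nothing-left e G E q 0≤x)

  runFrom-coupling t T U s halts E G p q = begin
    probability (runFrom M a T s) E ℚ.+ probability (runFrom M b U s) G
      -- The random choices are shared here: both runs are in state `s`, so both probabilities are
      -- means over the same draw `i`.
      ≡⟨ mean-+ (λ i → probability (perform M a T (act s i)) (λ ω → E (i , ω)))
                (λ i → probability (perform M b U (act s i)) (λ ω → G (i , ω))) ⟨
    mean (λ i → probability (perform M a T (act s i)) (λ ω → E (i , ω)) ℚ.+
                probability (perform M b U (act s i)) (λ ω → G (i , ω)))
      ≤⟨ mean-mono-≤ (λ i → perform-coupling t T U (act s i) (λ ω → halts (i , ω))
           (λ ω → E (i , ω)) (λ ω → G (i , ω)) (λ ω → p (i , ω)) (λ ω → q (i , ω))) ⟩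
    mean (λ i → 1ℚ ℚ.+ readsBy M a t (act s i) j)
      ≡⟨ mean-+ (const 1ℚ) (λ i → readsBy M a t (act s i) j) ⟩
    mean {draws s} (const 1ℚ) ℚ.+ readsFrom M a t s j
      ≡⟨ cong (λ z → z ℚ.+ readsFrom M a t s j) (mean-const (draws s) 1ℚ) ⟩
    1ℚ ℚ.+ readsFrom M a t s j ∎
    where open ℚₚ.≤-Reasoning

  -- Without time left, any action but halting would time out, contrary to `halts`.
  perform-coupling zero    T U (compute s) halts = contradiction refl (halts tt)
  perform-coupling zero    T U (read i k)  halts = contradiction refl (halts tt)
  perform-coupling t T U (halt x) halts E G p q =
    ℚₚ.≤-trans (probability-disjoint disjoint {x} {E} {G} p q) (1≤1+ (readsBy-nonneg M a t (halt x) j))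
  perform-coupling (suc t) zero U α@(compute s) halts E G p q =
    nothing-left (perform M b U α) E G p (readsBy-nonneg M a (suc t) α j)
  perform-coupling (suc t) zero U α@(read i k) halts E G p q =
    nothing-left (perform M b U α) E G p (readsBy-nonneg M a (suc t) α j)
  perform-coupling (suc t) (suc T) zero α@(compute s) halts E G p q =
    nothing-right (perform M a (suc T) α) E G q (readsBy-nonneg M a (suc t) α j)
  perform-coupling (suc t) (suc T) zero α@(read i k) halts E G p q =
    nothing-right (perform M a (suc T) α) E G q (readsBy-nonneg M a (suc t) α j)
  perform-coupling (suc t) (suc T) (suc U) (compute s) halts E G p q =
    runFrom-coupling t T U s halts E G p q
  perform-coupling (suc t) (suc T) (suc U) (read i k) halts E G p q with i ≟ j
  -- After a read at `j` the runs may diverge, but this read adds 1 to the right side, which leaves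
  -- room for two arbitrary probabilities.
  ... | yes _ = ℚₚ.+-mono-≤
    (probability-≤1 (runFrom M a T (k (lookup a i))) E)
    (ℚₚ.≤-trans (probability-≤1 (runFrom M b U (k (lookup b i))) G)
                (1≤1+ (readsFrom-nonneg M a t (k (lookup a i)) j)))
  -- Both inputs show the same item at `i`, so the two runs continue from the same state.
  ... | no i≢j rewrite agree i i≢j = subst
    (λ z → probability (runFrom M a T s′) E ℚ.+ probability (runFrom M b U s′) G ℚ.≤ 1ℚ ℚ.+ z)
    (sym (ℚₚ.+-identityˡ (readsFrom M a t s′ j)))
    (runFrom-coupling t T U s′ halts E G p q)
    where s′ = k (lookup a i)

-- From reads at every position to running time.

module _ {n} (M : Machine n) (a : Vec ℝ n) (b : Fin n → Vec ℝ n)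
  (agree : ∀ j i → i ≢ j → lookup (b j) i ≡ lookup a i)
  {P : ℝ → Set} {Q : Fin n → ℝ → Set} (disjoint : ∀ j {x} → P x → Q j x → ⊥) where

  quarter≤time : OutputProbabilityAtLeast M a (+ 3 ℚ./ 4) P →
                 (∀ j → OutputProbabilityAtLeast M (b j) (+ 3 ℚ./ 4) (Q j)) →
                 ∀ t → (∀ ω → value (run M a t) ω ≢ nothing) →
                 (+ n ℚ./ 1) ℚ.* (+ 1 ℚ./ 4) ℚ.≤ + t ℚ./ 1
  quarter≤time outP outQ t halts = begin
    + n ℚ./ 1 ℚ.* (+ 1 ℚ./ 4)      ≡⟨ sum-const n (+ 1 ℚ./ 4) ⟨
    sum {n} (const (+ 1 ℚ./ 4))    ≤⟨ sum-mono-≤ quarter≤reads ⟩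
    sum (readsFrom M a t start)    ≤⟨ sum-readsFrom M a t start ⟩
    + t ℚ./ 1                      ∎
    where
    open ℚₚ.≤-Reasoning hiding (start)
    open Machine M using (start)
    -- Success within a bounded time is guaranteed only for probabilities strictly below 3/4. Two
    -- copies of 5/8 exceed 1 by exactly 1/4.
    5/8<3/4 : + 5 ℚ./ 8 ℚ.< + 3 ℚ./ 4
    5/8<3/4 = toWitness {a? = _ ℚₚ.<? _} tt
    quarter≤reads : ∀ j → + 1 ℚ./ 4 ℚ.≤ readsFrom M a t start j
    quarter≤reads j with outP (+ 5 ℚ./ 8) 5/8<3/4 | outQ j (+ 5 ℚ./ 8) 5/8<3/4
    ... | T , E , p , ≤E | U , G , q , ≤G = subst (+ 1 ℚ./ 4 ℚ.≤_)
      (solve 1 (λ r → con (ℚ.- 1ℚ) :+ (con 1ℚ :+ r) := r) refl (readsFrom M a t start j))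
      (ℚₚ.+-monoʳ-≤ (ℚ.- 1ℚ) (ℚₚ.≤-trans (ℚₚ.+-mono-≤ ≤E ≤G)
        (Coupling.runFrom-coupling M a (b j) j (agree j) (disjoint j) t T U start halts E G p q)))
      where open +-*-Solver

-- Eventual inequalities and totals of vectors.

Eventually : (ℕ → Set) → Set
Eventually P = ∃[ N ] ∀ n → N ℕ.≤ n → P n

module _ {P Q : ℕ → Set} where

  _∧_ : Eventually P → Eventually Q → Eventually (λ n → P n × Q n)
  (M , p) ∧ (N , q) = M ℕ.⊔ N , λ n ≤n →
    p n (ℕₚ.m⊔n≤o⇒m≤o M N ≤n) , q n (ℕₚ.m⊔n≤o⇒n≤o M N ≤n)

≤-intro : ∀ {x y} → Eventually (λ n → seq x n ℚ.≤ seq y n) → x ≤ y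
≤-intro {y = y} (N , h) ε 0<ε = N , λ n N≤n → ℚₚ.≤-trans (h n N≤n)
  (subst (ℚ._≤ seq y n ℚ.+ ε) (ℚₚ.+-identityʳ (seq y n)) (ℚₚ.+-monoʳ-≤ (seq y n) (ℚₚ.<⇒≤ 0<ε)))

all-updateAt : ∀ {n} {P : ℝ → Set} {g} → (∀ {x} → P x → P (g x)) →
               ∀ {a : Vec ℝ n} → All P a → ∀ j → All P (updateAt a j g)
all-updateAt g-pres (p ∷ ps) zero    = g-pres p ∷ ps
all-updateAt g-pres (p ∷ ps) (suc j) = p ∷ all-updateAt g-pres ps j

-- Real addition is termwise on sequences, so the totals can be compared by exact equality of
-- rational terms rather than by `_≃_`.
total-updateAt : ∀ {n} w (a : Vec ℝ n) j m →
                 seq (total (updateAt a j (_+_ w))) m ≡ seq w m ℚ.+ seq (total a) m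
total-updateAt w (x ∷ a) zero    m = ℚₚ.+-assoc (seq w m) (seq x m) (seq (total a) m)
total-updateAt w (x ∷ a) (suc j) m = trans
  (cong (λ z → seq x m ℚ.+ z) (total-updateAt w a j m))
  (solve 3 (λ x w t → x :+ (w :+ t) := w :+ (x :+ t)) refl (seq x m) (seq w m) (seq (total a) m))
  where open +-*-Solver

concentrated : ℝ → ∀ n → Vec ℝ n
concentrated x zero    = []
concentrated x (suc n) = x ∷ replicate n 0ℝ

total-zeros : ∀ n m → seq (total (replicate n 0ℝ)) m ≡ 0ℚ
total-zeros zero    m = refl
total-zeros (suc n) m = trans (ℚₚ.+-identityˡ _) (total-zeros n m)

total-concentrated : ∀ x n m → .{{_ : ℕ.NonZero n}} → seq (total (concentrated x n)) m ≡ seq x m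
total-concentrated x (suc n) m =
  trans (cong (λ z → seq x m ℚ.+ z) (total-zeros n m)) (ℚₚ.+-identityʳ (seq x m))

all-concentrated : ∀ {P : ℝ → Set} {x} → P x → P 0ℝ → ∀ n → All P (concentrated x n)
all-concentrated px p0 zero    = []
all-concentrated px p0 (suc n) = px ∷ zeros n
  where
  zeros : ∀ n → All _ (replicate n 0ℝ)
  zeros zero    = []
  zeros (suc n) = p0 ∷ zeros n

-- No common approximation for the two sums.

-- A common approximation would be at most `k F` and at least `c F / k`, although `k` stays below
-- `√ c` by a positive margin. It is enough to refute this in rational arithmetic at one index where
-- all the eventual inequalities hold.
approximations-disjoint :
  ∀ {c ε F} → 1ℝ < c → 0ℝ < ε → (1≤k : 1ℝ ≤ √ c - ε) → 1ℚ ℚ.≤ F → ∀ {n} (a b : Vec ℝ n) →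
  (∀ m → seq (total a) m ≡ F) → (∀ m → seq (total b) m ≡ seq c m ℚ.* F) →
  ∀ {s} → IsApproximation (√ c - ε) 1≤k a s → IsApproximation (√ c - ε) 1≤k b s → ⊥
approximations-disjoint {c} {ε} {F} 1<c (e , 0<e , ev-ε) 1≤k 1≤F a b total-a total-b {s}
  (_ , s≤ka) (b/k≤s , _) =
  let δ , 0<δ , ev-k = <⇒eventually-≥ {√ c - ε} (1≤⇒0< {√ c - ε} 1≤k)
      -- Slack 1 in `1 ≤ c` still yields `0 ≤ seq c m`. The slacks `½ * e` are those that
      -- `gap-contradiction` absorbs.
      N , ev = ev-ε ∧ (ev-k ∧ (<⇒≤ {1ℝ} {c} 1<c 1ℚ 0<1 ∧
               (s≤ka (½ ℚ.* e) (half-pos 0<e) ∧ b/k≤s (½ ℚ.* e) (half-pos 0<e))))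
      e≤ε , δ≤k , 1≤c+1 , upper , lower = ev N ℕₚ.≤-refl
  in impossible N e≤ε (ℚₚ.<-≤-trans 0<δ δ≤k) (0≤-cancel 1≤c+1) upper lower
  where
  open ℚₚ.≤-Reasoning
  open +-*-Solver
  k = √ c - ε
  0≤-cancel : ∀ {x} → 1ℚ ℚ.≤ x ℚ.+ 1ℚ → 0ℚ ℚ.≤ x
  0≤-cancel {x} h = subst (0ℚ ℚ.≤_) (solve 1 (λ x → x :+ con 1ℚ :+ con (ℚ.- 1ℚ) := x) refl x)
    (ℚₚ.+-monoˡ-≤ (ℚ.- 1ℚ) h)
  impossible : ∀ m → 0ℚ ℚ.+ e ℚ.≤ seq ε m → 0ℚ ℚ.< seq k m → 0ℚ ℚ.≤ seq c m →
    seq s m ℚ.≤ seq k m ℚ.* seq (total a) m ℚ.+ ½ ℚ.* e →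
    recip (seq k m) ℚ.* seq (total b) m ℚ.≤ seq s m ℚ.+ ½ ℚ.* e → ⊥
  impossible m e≤ε 0<k 0≤c upper lower = gap-contradiction 0<k 0<e k+e≤r r²≤c 1≤F
    (subst (λ z → seq s m ℚ.≤ kₘ ℚ.* z ℚ.+ ½ ℚ.* e) (total-a m) upper)
    (subst (λ z → recip kₘ ℚ.* z ℚ.≤ seq s m ℚ.+ ½ ℚ.* e) (total-b m) lower)
    where
    kₘ = seq k m
    r  = seq (√ c) m
    k+e≤r : kₘ ℚ.+ e ℚ.≤ r
    k+e≤r = begin
      r ℚ.- seq ε m ℚ.+ e           ≡⟨ cong (λ z → r ℚ.- seq ε m ℚ.+ z) (ℚₚ.+-identityˡ e) ⟨
      r ℚ.- seq ε m ℚ.+ (0ℚ ℚ.+ e)  ≤⟨ ℚₚ.+-monoʳ-≤ (r ℚ.- seq ε m) e≤ε ⟩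
      r ℚ.- seq ε m ℚ.+ seq ε m     ≡⟨ solve 2 (λ r e → r :- e :+ e := r) refl r (seq ε m) ⟩
      r                             ∎
    -- `root` rounds down, so the bound is exact at index `m` once nonnegativity turns
    -- `0ℚ ⊔ seq c m` into `seq c m`.
    r²≤c : r ℚ.* r ℚ.≤ seq c m
    r²≤c = subst (r ℚ.* r ℚ.≤_) (ℚₚ.p≤q⇒p⊔q≡q 0≤c) (root-lower m (ℚₚ.p≤p⊔q 0ℚ (seq c m)))

-- The hard inputs and their membership in the class.

-- Eventually `c` is at least 1 and hence `F / c ≤ F`, so the interval from `F` to `c F` lies in the
-- admissible one; the two kinds of input have their totals at its ends.
sumProblem-intro : ∀ c (1<c : 1ℝ < c) f {n} {a : Vec ℝ n} → All (0ℝ ≤_) a →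
  (∀ m → 1ℚ ℚ.≤ seq c m → + f n ℚ./ 1 ℚ.≤ seq (total a) m × seq (total a) m ℚ.≤ seq c m ℚ.* (+ f n ℚ./ 1)) →
  SumProblem c 1<c f n a
sumProblem-intro c 1<c@(d , 0<d , N , 1+d≤c) f {n} {a} 0≤a bounds =
    0≤a
  , ≤-intro {fromℕ (f n) * c ⁻¹⟨ 1≤⇒0< {c} (<⇒≤ {1ℝ} {c} 1<c) ⟩} {total a} (N , λ m N≤m → ℚₚ.≤-trans
       (F/c≤F m (1≤c m N≤m)) (proj₁ (bounds m (1≤c m N≤m))))
  , ≤-intro {total a} {c * fromℕ (f n)} (N , λ m N≤m → proj₂ (bounds m (1≤c m N≤m)))
  where
  F = + f n ℚ./ 1
  1≤c : ∀ m → N ℕ.≤ m → 1ℚ ℚ.≤ seq c m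
  1≤c m N≤m = ℚₚ.≤-trans (ℚₚ.+-monoʳ-≤ 1ℚ (ℚₚ.<⇒≤ 0<d)) (1+d≤c m N≤m)
  F/c≤F : ∀ m → 1ℚ ℚ.≤ seq c m → F ℚ.* recip (seq c m) ℚ.≤ F
  F/c≤F m 1≤cₘ = subst (F ℚ.* recip (seq c m) ℚ.≤_) (ℚₚ.*-identityʳ F)
    (mul-mono-≤ (grid-nonneg 0 (f n)) ℚₚ.≤-refl (ℚₚ.<⇒≤ (recip-pos (ℚₚ.<-≤-trans 0<1 1≤cₘ))) (recip-mono 0<1 1≤cₘ))

module Inputs (c : ℝ) (1<c : 1ℝ < c) (f : ℕ → ℕ) (n : ℕ) .{{_ : ℕ.NonZero n}} where

  F : ℚ
  F = + f n ℚ./ 1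

  surplus : ℝ
  surplus = (c - 1ℝ) * fromℚ F

  light : Vec ℝ n
  light = concentrated (fromℚ F) n

  heavy : Fin n → Vec ℝ n
  heavy j = updateAt light j (_+_ surplus)

  heavy-agree : ∀ j i → i ≢ j → lookup (heavy j) i ≡ lookup light i
  heavy-agree j i i≢j = lookup∘updateAt′ i j i≢j light

  total-light : ∀ m → seq (total light) m ≡ F
  total-light m = total-concentrated (fromℚ F) n m

  total-heavy : ∀ j m → seq (total (heavy j)) m ≡ seq c m ℚ.* F
  total-heavy j m = begin
    seq (total (heavy j)) m                   ≡⟨ total-updateAt surplus light j m ⟩
    seq surplus m ℚ.+ seq (total light) m     ≡⟨ cong (λ z → seq surplus m ℚ.+ z) (total-light m) ⟩
    (seq c m ℚ.- 1ℚ) ℚ.* F ℚ.+ F              ≡⟨ solve 2 (λ c f → (c :+ con (ℚ.- 1ℚ)) :* f :+ f := c :* f) refl (seq c m) F ⟩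
    seq c m ℚ.* F                             ∎
    where open ≡-Reasoning
          open +-*-Solver

  F≤cF : ∀ {x} → 1ℚ ℚ.≤ x → F ℚ.≤ x ℚ.* F
  F≤cF {x} 1≤x = subst (ℚ._≤ x ℚ.* F) (ℚₚ.*-identityˡ F)
    (mul-mono-≤ (ℚₚ.<⇒≤ 0<1) 1≤x (grid-nonneg 0 (f n)) ℚₚ.≤-refl)

  light-nonneg : All (0ℝ ≤_) light
  light-nonneg = all-concentrated
    (≤-intro {0ℝ} {fromℚ F} (0 , λ _ _ → grid-nonneg 0 (f n)))
    (≤-intro {0ℝ} {0ℝ} (0 , λ _ _ → ℚₚ.≤-refl)) n

  0≤surplus : Eventually λ m → 0ℚ ℚ.≤ seq surplus m
  0≤surplus = let d , 0<d , N , h = 1<c in N , λ m N≤m → mul-nonneg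
    (ℚₚ.≤-trans (ℚₚ.<⇒≤ 0<d) (subst (ℚ._≤ seq c m ℚ.- 1ℚ)
      (solve 1 (λ d → con 1ℚ :+ d :+ con (ℚ.- 1ℚ) := d) refl d) (ℚₚ.+-monoˡ-≤ (ℚ.- 1ℚ) (h m N≤m))))
    (grid-nonneg 0 (f n))
    where open +-*-Solver

  +-surplus-nonneg : ∀ {x} → 0ℝ ≤ x → 0ℝ ≤ surplus + x
  +-surplus-nonneg {x} 0≤x ε 0<ε = let N , h = 0≤surplus ∧ 0≤x ε 0<ε in N , λ m N≤m →
    subst (0ℚ ℚ.≤_) (sym (ℚₚ.+-assoc (seq surplus m) (seq x m) ε))
      (ℚₚ.+-mono-≤ (proj₁ (h m N≤m)) (proj₂ (h m N≤m)))

  light-valid : SumProblem c 1<c f n light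
  light-valid = sumProblem-intro c 1<c f light-nonneg λ m 1≤c →
    subst (λ z → F ℚ.≤ z × z ℚ.≤ seq c m ℚ.* F) (sym (total-light m)) (ℚₚ.≤-refl , F≤cF 1≤c)

  heavy-valid : ∀ j → SumProblem c 1<c f n (heavy j)
  heavy-valid j = sumProblem-intro c 1<c f
    (all-updateAt (λ {x} → +-surplus-nonneg {x}) light-nonneg j) λ m 1≤c →
    subst (λ z → F ℚ.≤ z × z ℚ.≤ seq c m ℚ.* F) (sym (total-heavy j m)) (F≤cF 1≤c , ℚₚ.≤-refl)

-- The lower bound on the running time.

1≤fromℕ : ∀ n → .{{_ : ℕ.NonZero n}} → 1ℚ ℚ.≤ + n ℚ./ 1
1≤fromℕ (suc n) = subst (1ℚ ℚ.≤_) (sym (fromℕ-suc n)) (ℚₚ.+-monoʳ-≤ 1ℚ (grid-nonneg 0 n))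

/-≤ : ∀ n d → .{{_ : ℕ.NonZero d}} → + n ℚ./ d ℚ.≤ + n ℚ./ 1
/-≤ n (suc d) = ℚₚ.toℚᵘ-cancel-≤
  (ℚᵘₚ.≤-respˡ-≃ (ℚᵘₚ.≃-sym (toℚᵘ-/ (+ n) d)) (ℚᵘₚ.≤-respʳ-≃ (ℚᵘₚ.≃-sym (toℚᵘ-/ (+ n) 0))
    (ℚᵘ.*≤* (subst₂ ℤ._≤_ (ℤₚ.pos-* n 1) (ℤₚ.pos-* n (suc d))
      (ℤ.+≤+ (ℕₚ.*-monoʳ-≤ n {1} {suc d} (ℕ.s≤s ℕ.z≤n)))))))

theorem6 : (f : ℕ → ℕ) → Nondecreasing f → Unbounded f → IsLittleO[n] f →
    (c : ℝ) (1<c : 1ℝ < c) →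
    (ε : ℝ) → 0ℝ < ε → (ε<√c-1 : ε < √ c - 1ℝ) →
    (A : ∀ n → Machine n) →
    IsApproximationAlgorithm (√ c - ε) (<⇒≤ {1ℝ} {√ c - ε} (<-minus-swap {ε} {√ c} {1ℝ} ε<√c-1))
    (SumProblem c 1<c f) A →
    Needs-Ω[n/ f ] (SumProblem c 1<c f) A
theorem6 f _ _ _ c 1<c ε 0<ε ε<√c-1 A approximates =
  -- The constant is the lower bound 1/4 on the expected reads at each position. The threshold 1
  -- provides an item to carry the sum.
  fromℚ ¼ , (¼ , 0<¼ , 0 , λ _ _ → ℚₚ.≤-refl) , 1 , slow
  where
  ¼ = + 1 ℚ./ 4
  0<¼ : 0ℚ ℚ.< ¼
  0<¼ = unit-pos 3
  1≤k = <⇒≤ {1ℝ} {√ c - ε} (<-minus-swap {ε} {√ c} {1ℝ} ε<√c-1)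
  slow : ∀ n → 1 ℕ.≤ n → .{{_ : ℕ.NonZero (f n)}} →
    WorstCaseTimeAtLeast (fromℚ ¼ * fromℚ (+ n ℚ./ f n)) (SumProblem c 1<c f n) (A n)
  slow n@(suc _) _ t (d , 0<d , N , h) = light , light-valid , runs-long
    where
    open Inputs c 1<c f n
    open ℚₚ.≤-Reasoning
    too-short : + t ℚ./ 1 ℚ.< + n ℚ./ 1 ℚ.* ¼
    too-short = begin-strict
      + t ℚ./ 1              ≡⟨ ℚₚ.+-identityʳ (+ t ℚ./ 1) ⟨
      + t ℚ./ 1 ℚ.+ 0ℚ       <⟨ ℚₚ.+-monoʳ-< (+ t ℚ./ 1) 0<d ⟩
      -- Both reals are constant sequences, so one index gives the rational inequality.
      + t ℚ./ 1 ℚ.+ d        ≤⟨ h N ℕₚ.≤-refl ⟩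
      -- Since `f n ≥ 1`, the quotient is at most `n`, and `t` falls below the bound `n / 4` of
      -- `quarter≤time`.
      ¼ ℚ.* (+ n ℚ./ f n)    ≤⟨ ℚₚ.*-monoˡ-≤-nonNeg ¼ (/-≤ n (f n)) ⟩
      ¼ ℚ.* (+ n ℚ./ 1)      ≡⟨ ℚₚ.*-comm ¼ (+ n ℚ./ 1) ⟩
      + n ℚ./ 1 ℚ.* ¼        ∎
    runs-long : CanRunLongerThan (A n) light t
    runs-long = decidable-stable (canTimeOut? (run (A n) light t)) λ halts →
      ℚₚ.<⇒≢ (ℚₚ.<-≤-trans too-short
        (quarter≤time (A n) light heavy heavy-agree
          {IsApproximation (√ c - ε) 1≤k light} {λ j → IsApproximation (√ c - ε) 1≤k (heavy j)}
          (λ j {s} → approximations-disjoint {c} {ε} {F} 1<c 0<ε 1≤k (1≤fromℕ (f n))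
            light (heavy j) total-light (total-heavy j) {s})
          (approximates n light light-valid) (λ j → approximates n (heavy j) (heavy-valid j))
          t (λ ω eq → halts (ω , eq)))) refl
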